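{- Let $L$ be any one of the sequent calculi $\mathrm{LJ}^+$, $\mathrm{sC}$, $\mathrm{sC3}$, $\mathrm{sMC}$, $\mathrm{sCN}$. For every formula $\alpha$ and every finite set $\Gamma$ of formulas (in the language of $L$), the sequent $\alpha,\Gamma\Rightarrow\alpha$ is provable in $L$.
   Context: Formulas of $\mathrm{sC},\mathrm{sC3},\mathrm{sMC},\mathrm{sCN}$ are built from countably many propositional variables $p,q,\dots$ using the binary connectives $\land,\lor,\to$ and the unary connective $\sim$; the language of $\mathrm{LJ}^+$ (positive intuitionistic logic) has only $\land,\lor,\to$ and no $\sim$. A sequent is an expression $\Gamma\Rightarrow\gamma$ with $\Gamma$ a finite (possibly empty) set of formulas and $\gamma$ a single formula; $\alpha,\Gamma$ means $\{\alpha\}\cup\Gamma$ and $\Gamma,\Delta$ means $\Gamma\cup\Delta$. Below, $p$ is any propositional variable, $\alpha,\beta,\gamma$ any formulas, $\Gamma,\Delta,\Sigma$ any finite sets of formulas. $\mathrm{LJ}^+$ has initial sequents (init1) $p,\Gamma\Rightarrow p$ and rules: (cut): from $\Gamma\Rightarrow\alpha$ and $\alpha,\Sigma\Rightarrow\gamma$ infer $\Gamma,\Sigma\Rightarrow\gamma$. ($\to$left): from $\Gamma\Rightarrow\alpha$ and $\beta,\Delta\Rightarrow\gamma$ infer $\alpha\to\beta,\Gamma,\Delta\Rightarrow\gamma$. ($\to$right): from $\alpha,\Gamma\Rightarrow\beta$ infer $\Gamma\Rightarrow\alpha\to\beta$. ($\land$left): from $\alpha,\beta,\Gamma\Rightarrow\gamma$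 infer $\alpha\land\beta,\Gamma\Rightarrow\gamma$. ($\land$right): from $\Gamma\Rightarrow\alpha$ and $\Gamma\Rightarrow\beta$ infer $\Gamma\Rightarrow\alpha\land\beta$. ($\lor$left): from $\alpha,\Gamma\Rightarrow\gamma$ and $\beta,\Gamma\Rightarrow\gamma$ infer $\alpha\lor\beta,\Gamma\Rightarrow\gamma$. ($\lor$right1), ($\lor$right2): from $\Gamma\Rightarrow\alpha$ (respectively $\Gamma\Rightarrow\beta$) infer $\Gamma\Rightarrow\alpha\lor\beta$. $\mathrm{sC}$ is $\mathrm{LJ}^+$ (over the full language) plus initial sequents (init2) $\sim p,\Gamma\Rightarrow\sim p$ and rules: ($\sim$left): from $\alpha,\Gamma\Rightarrow\gamma$ infer $\sim\sim\alpha,\Gamma\Rightarrow\gamma$. ($\sim$right): from $\Gamma\Rightarrow\alpha$ infer $\Gamma\Rightarrow\sim\sim\alpha$. ($\sim\to$left): from $\Gamma\Rightarrow\alpha$ and $\sim\beta,\Delta\Rightarrow\gamma$ infer $\sim(\alpha\to\beta),\Gamma,\Delta\Rightarrow\gamma$. ($\sim\to$right): from $\alpha,\Gamma\Rightarrow\sim\beta$ infer $\Gamma\Rightarrow\sim(\alpha\to\beta)$. ($\sim\land$left): from $\sim\alpha,\Gamma\Rightarrow\gamma$ and $\sim\beta,\Gamma\Rightarrow\gamma$ infer $\sim(\alpha\land\beta),\Gamma\Rightarrow\gamma$. ($\sim\land$right1), ($\sim\land$right2): from $\Gamma\Rightarrow\sim\alpha$ (respectively $\Gamma\Rightarrow\sim\beta$)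 infer $\Gamma\Rightarrow\sim(\alpha\land\beta)$. ($\sim\lor$left): from $\sim\alpha,\sim\beta,\Gamma\Rightarrow\gamma$ infer $\sim(\alpha\lor\beta),\Gamma\Rightarrow\gamma$. ($\sim\lor$right): from $\Gamma\Rightarrow\sim\alpha$ and $\Gamma\Rightarrow\sim\beta$ infer $\Gamma\Rightarrow\sim(\alpha\lor\beta)$. Additional rules: (ex-middle): from $\sim\alpha,\Gamma\Rightarrow\gamma$ and $\alpha,\Gamma\Rightarrow\gamma$ infer $\Gamma\Rightarrow\gamma$. (Peirce): from $\alpha\to\beta,\Gamma\Rightarrow\alpha$ infer $\Gamma\Rightarrow\alpha$. $\mathrm{sC3}=\mathrm{sC}+$(ex-middle); $\mathrm{sMC}=\mathrm{sC}+$(Peirce); $\mathrm{sCN}=\mathrm{sC3}+$(Peirce). -}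

module Defs where

open import Data.List using (List; _∷_; _++_)
open import Data.List.Relation.Binary.BagAndSetEquality using (_∼[_]_; set)
open import Data.Nat using (ℕ)

data Language : Set where
  positive full : Language

infixr 7 _∧_
infixr 6 _∨_
infixr 5 _⟶_
infix  8 ∼_

data Formula : Language → Set where
  var         : ∀ {ℓ} → ℕ → Formula ℓ
  _∧_ _∨_ _⟶_ : ∀ {ℓ} → Formula ℓ → Formula ℓ → Formula ℓ
  ∼_          : Formula full → Formula full

data Calculus : Language → Set where
  LJ⁺            : Calculus positive
  sC sC3 sMC sCN : Calculus full

data HasExMiddle : Calculus full → Set where
  sC3 : HasExMiddle sC3
  sCN : HasExMiddle sCN

data HasPeirce : Calculus full → Set where
  sMC : HasPeirce sMC
  sCN : HasPeirce sCN

-- A finite set of formulas is represented by a list, two lists denoting the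
-- same set when they have the same members (_∼[ set ]_).

Context : Language → Set
Context ℓ = List (Formula ℓ)

infix 3 _⊢_⇒_

-- L ⊢ Γ ⇒ γ is the type of derivations of the sequent Γ ⇒ γ in L.
-- The constructor same-set is not an inference rule of the calculi: it
-- identifies lists denoting the same set, so that the other constructors
-- are rules on finite sets (with {α} ∪ Γ as α ∷ Γ and Γ ∪ Δ as Γ ++ Δ).

data _⊢_⇒_ : ∀ {ℓ} → Calculus ℓ → Context ℓ → Formula ℓ → Set where

  same-set : ∀ {ℓ} {L : Calculus ℓ} {Γ Δ γ} →
             Γ ∼[ set ] Δ → L ⊢ Γ ⇒ γ → L ⊢ Δ ⇒ γ

  init1   : ∀ {ℓ} {L : Calculus ℓ} {p Γ} →
            L ⊢ var p ∷ Γ ⇒ var p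
  cut     : ∀ {ℓ} {L : Calculus ℓ} {Γ Σ α γ} →
            L ⊢ Γ ⇒ α → L ⊢ α ∷ Σ ⇒ γ → L ⊢ Γ ++ Σ ⇒ γ
  ⟶left   : ∀ {ℓ} {L : Calculus ℓ} {Γ Δ α β γ} →
            L ⊢ Γ ⇒ α → L ⊢ β ∷ Δ ⇒ γ → L ⊢ (α ⟶ β) ∷ Γ ++ Δ ⇒ γ
  ⟶right  : ∀ {ℓ} {L : Calculus ℓ} {Γ α β} →
            L ⊢ α ∷ Γ ⇒ β → L ⊢ Γ ⇒ α ⟶ β
  ∧left   : ∀ {ℓ} {L : Calculus ℓ} {Γ α β γ} →
            L ⊢ α ∷ β ∷ Γ ⇒ γ → L ⊢ (α ∧ β) ∷ Γ ⇒ γ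
  ∧right  : ∀ {ℓ} {L : Calculus ℓ} {Γ α β} →
            L ⊢ Γ ⇒ α → L ⊢ Γ ⇒ β → L ⊢ Γ ⇒ α ∧ β
  ∨left   : ∀ {ℓ} {L : Calculus ℓ} {Γ α β γ} →
            L ⊢ α ∷ Γ ⇒ γ → L ⊢ β ∷ Γ ⇒ γ → L ⊢ (α ∨ β) ∷ Γ ⇒ γ
  ∨right1 : ∀ {ℓ} {L : Calculus ℓ} {Γ α β} →
            L ⊢ Γ ⇒ α → L ⊢ Γ ⇒ α ∨ β
  ∨right2 : ∀ {ℓ} {L : Calculus ℓ} {Γ α β} →
            L ⊢ Γ ⇒ β → L ⊢ Γ ⇒ α ∨ β

  init2    : ∀ {L : Calculus full} {p Γ} →
             L ⊢ ∼ var p ∷ Γ ⇒ ∼ var p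
  ∼left    : ∀ {L : Calculus full} {Γ α γ} →
             L ⊢ α ∷ Γ ⇒ γ → L ⊢ ∼ ∼ α ∷ Γ ⇒ γ
  ∼right   : ∀ {L : Calculus full} {Γ α} →
             L ⊢ Γ ⇒ α → L ⊢ Γ ⇒ ∼ ∼ α
  ∼⟶left   : ∀ {L : Calculus full} {Γ Δ α β γ} →
             L ⊢ Γ ⇒ α → L ⊢ ∼ β ∷ Δ ⇒ γ → L ⊢ ∼ (α ⟶ β) ∷ Γ ++ Δ ⇒ γ
  ∼⟶right  : ∀ {L : Calculus full} {Γ α β} →
             L ⊢ α ∷ Γ ⇒ ∼ β → L ⊢ Γ ⇒ ∼ (α ⟶ β)
  ∼∧left   : ∀ {L : Calculus full} {Γ α β γ} →
             L ⊢ ∼ α ∷ Γ ⇒ γ → L ⊢ ∼ β ∷ Γ ⇒ γ → L ⊢ ∼ (α ∧ β) ∷ Γ ⇒ γ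
  ∼∧right1 : ∀ {L : Calculus full} {Γ α β} →
             L ⊢ Γ ⇒ ∼ α → L ⊢ Γ ⇒ ∼ (α ∧ β)
  ∼∧right2 : ∀ {L : Calculus full} {Γ α β} →
             L ⊢ Γ ⇒ ∼ β → L ⊢ Γ ⇒ ∼ (α ∧ β)
  ∼∨left   : ∀ {L : Calculus full} {Γ α β γ} →
             L ⊢ ∼ α ∷ ∼ β ∷ Γ ⇒ γ → L ⊢ ∼ (α ∨ β) ∷ Γ ⇒ γ
  ∼∨right  : ∀ {L : Calculus full} {Γ α β} →
             L ⊢ Γ ⇒ ∼ α → L ⊢ Γ ⇒ ∼ β → L ⊢ Γ ⇒ ∼ (α ∨ β)

  ex-middle : ∀ {L : Calculus full} {Γ α γ} → HasExMiddle L →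
              L ⊢ ∼ α ∷ Γ ⇒ γ → L ⊢ α ∷ Γ ⇒ γ → L ⊢ Γ ⇒ γ
  Peirce    : ∀ {L : Calculus full} {Γ α β} → HasPeirce L →
              L ⊢ (α ⟶ β) ∷ Γ ⇒ α → L ⊢ Γ ⇒ α

{-# OPTIONS --safe #-}
module Submission where

open import Data.List using ([]; _∷_)
open import Data.List.Relation.Binary.BagAndSetEquality using (↭⇒∼bag; bag-=⇒)
open import Data.List.Relation.Binary.Permutation.Propositional using (↭-refl; ↭-swap)
open import Defs

-- Each connective, plain or negated, has matching left and right rules: together they reduce the
-- sequent for a compound formula to those for its parts, ending in `init1` or `init2`. The same
-- derivation serves every calculus.

exchange : ∀ {ℓ} {L : Calculus ℓ} {α β γ Γ} → L ⊢ α ∷ β ∷ Γ ⇒ γ → L ⊢ β ∷ α ∷ Γ ⇒ γ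
exchange = same-set (bag-=⇒ (↭⇒∼bag (↭-swap _ _ ↭-refl)))

-- Induction in which ∼ α counts as smaller than ∼ (α ∘ β): the rules for ∼
-- push the negation inwards, so a negated formula reduces to its negated parts.
proposition2p3 : ∀ {ℓ} (L : Calculus ℓ) (α : Formula ℓ) (Γ : Context ℓ) → L ⊢ α ∷ Γ ⇒ α
proposition2p3 L (var p) Γ = init1
proposition2p3 L (α ∧ β) Γ =
  ∧left (∧right (proposition2p3 L α (β ∷ Γ)) (exchange (proposition2p3 L β (α ∷ Γ))))
proposition2p3 L (α ∨ β) Γ =
  ∨left (∨right1 (proposition2p3 L α Γ)) (∨right2 (proposition2p3 L β Γ))
proposition2p3 L (α ⟶ β) Γ =
  -- `⟶left` joins the contexts of its premises; with `[]` here the join `(α ∷ []) ++ Γ` computes to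
  -- `α ∷ Γ`.
  ⟶right (exchange (⟶left (proposition2p3 L α []) (proposition2p3 L β Γ)))
proposition2p3 L (∼ var p) Γ = init2
proposition2p3 L (∼ (α ∧ β)) Γ =
  ∼∧left (∼∧right1 (proposition2p3 L (∼ α) Γ)) (∼∧right2 (proposition2p3 L (∼ β) Γ))
proposition2p3 L (∼ (α ∨ β)) Γ =
  ∼∨left (∼∨right (proposition2p3 L (∼ α) (∼ β ∷ Γ))
                  (exchange (proposition2p3 L (∼ β) (∼ α ∷ Γ))))
proposition2p3 L (∼ (α ⟶ β)) Γ =
  ∼⟶right (exchange (∼⟶left (proposition2p3 L α []) (proposition2p3 L (∼ β) Γ)))
proposition2p3 L (∼ ∼ α) Γ = ∼left (∼right (proposition2p3 L α Γ))
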